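{- Let $p$ be the minimum integer $n$ such that there exists a graph on $n$ vertices with odd girth $7$ and fractional chromatic number greater than $3+\frac{4}{n-1}$. Let $F$ be a graph with vertex set $V(F)=\{v_1,\dots,v_p\}$, odd girth $7$ and $\chi_f(F)>3+\frac{4}{p-1}$. Let $q\ge (p-1)/2$ be an integer, let $c=3q+2$, and let $G=F[K_q]$. Let $H$ be the graph with the following vertices and edges: (1) vertices $g_i$ for $i\in[c]$, forming a clique; (2) a vertex $\phi$, adjacent to $g_i$ for every $i\in[c]$ with $i>p$; (3) for each $i\in[p]$ and each $t\in[q+2,3q+2]$, a vertex $\mu_{i,t}$, where for each $i\in[p]$ the set $\{\mu_{i,t}: t\in[q+2,3q+2]\}\cup\{g_i\}$ forms a clique, and each vertex $\mu_{i,t}$ is further adjacent to every $g_j$ with $j\in[c]$, $j>2q+1$ and $j\ne t$; (4) for each $i\in[p]$ and each $t\in[2q+2,3q+2]$, a vertex $\theta_{i,t}$, adjacent to $\phi$, to $\mu_{i,t}$, and to every $g_j$ with $j\in[c]\setminus\{i,t\}$. (All these vertices are distinct, and $H$ has no other vertices or edges.) Then $$\chi(G)>c,\qquad \chi(H)>c,\qquad\text{and}\qquad \chi(G\times H)\le c.$$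
   Context: Graphs are finite and simple, and $\chi$ denotes the chromatic number. For a positive integer $c$, $[c]=\{1,2,\dots,c\}$, and for integers $a\le b$, $[a,b]=\{a,a+1,\dots,b\}$. The product $G\times H$ of graphs $G$ and $H$ has vertex set $V(G)\times V(H)$, with $(x,y)$ adjacent to $(x',y')$ if and only if $xx'\in E(G)$ and $yy'\in E(H)$. The lexicographic product $G[K_q]$ is the graph with vertex set $\{(x,i): x\in V(G), i\in[q]\}$ in which $(x,i)$ and $(y,j)$ are adjacent if and only if either $xy\in E(G)$, or $x=y$ and $i\neq j$. The fractional chromatic number of $G$ is $\chi_f(G)=\inf\{\chi(G[K_q])/q : q=1,2,\dots\}$. The odd girth of $G$ is the length of a shortest odd cycle in $G$. The existence of a graph of odd girth $7$ on some number $n$ of vertices with fractional chromatic number greater than $3+\frac{4}{n-1}$ (so that $p$ is well defined) is guaranteed by a classical result of Erdős. -}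

module Defs where

open import Data.Empty using (⊥)
open import Data.Fin using (Fin; toℕ; fromℕ<; finToFun; funToFin)
open import Data.Fin.Properties
  using (any?; all?; +↔⊎; *↔×; 1↔⊤; toℕ<n; toℕ-fromℕ<; toℕ-injective; finToFun-funToFin)
  renaming (_≟_ to _≟ᶠ_)
open import Data.Integer as ℤ using ()
open import Data.Nat
open import Data.Nat.DivMod using (_%_)
open import Data.Nat.Properties
open import Data.Product using (Σ-syntax; ∃; ∃-syntax; _×_; _,_; proj₁; proj₂)
open import Data.Product.Function.NonDependent.Propositional using (_×-↔_)
open import Data.Rational.Unnormalised as ℚᵘ using (ℚᵘ)
open import Data.Sum using (_⊎_; inj₁; inj₂)
open import Data.Sum.Function.Propositional using (_⊎-↔_)
open import Data.Unit using (⊤; tt)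
open import Function using (_∘_; _↔_; Inverse; mk↔ₛ′)
open import Function.Construct.Composition using (_↔-∘_)
open import Function.Construct.Identity using (↔-id)
open import Function.Construct.Symmetry using (↔-sym)
open import Function.Definitions using (Injective)
open import Function.Properties.Inverse using (↔⇒↣)
open import Level using (0ℓ)
open import Relation.Binary.Construct.Closure.Symmetric using (SymClosure; fwd; bwd; symmetric)
open import Relation.Binary.Core using (Rel)
open import Relation.Binary.Definitions using (Symmetric; Irreflexive; Decidable; DecidableEquality)
open import Relation.Binary.PropositionalEquality
open import Relation.Nullary using (¬_; yes; no; contradiction)
open import Relation.Nullary.Decidable
  using (map′; via-injection; _×-dec_; _⊎-dec_; _→-dec_; ¬?; recompute)
import Relation.Unary as U

IsLeast : ∀ {ℓ} → (ℕ → Set ℓ) → ℕ → Set ℓ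
IsLeast P n = P n × (∀ m → P m → n ≤ m)

least : ∀ {ℓ} {P : ℕ → Set ℓ} → U.Decidable P → ∃ P → ∃ (IsLeast P)
least P? (n , Pn) = search P? n Pn
  where
  search : ∀ {ℓ} {P : ℕ → Set ℓ} → U.Decidable P → ∀ n → P n → ∃ (IsLeast P)
  search P? n Pn with P? 0
  search P? n       Pn | yes P0 = 0 , P0 , λ _ _ → z≤n
  search P? zero    Pn | no ¬P0 = contradiction Pn ¬P0
  search P? (suc n) Pn | no ¬P0 with search (P? ∘ suc) n Pn
  ... | k , Pk , k≤ = suc k , Pk , λ where
    zero    P0 → contradiction P0 ¬P0
    (suc m) Pm → s≤s (k≤ m Pm)

record Graph : Set₁ where
  infix 4 _~_ _~?_
  field
    V      : Set
    order  : ℕ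
    enum   : V ↔ Fin order
    _~_    : Rel V 0ℓ
    _~?_   : Decidable _~_
    ~-sym  : Symmetric _~_
    ~-irr  : Irreflexive _≡_ _~_

  index : V → Fin order
  index = Inverse.to enum

  vertex : Fin order → V
  vertex = Inverse.from enum

  vertex-index : ∀ x → vertex (index x) ≡ x
  vertex-index = Inverse.strictlyInverseʳ enum

  _≟ⱽ_ : DecidableEquality V
  _≟ⱽ_ = via-injection (↔⇒↣ enum) _≟ᶠ_

open Graph using (V; order)

module _ (G : Graph) where
  open Graph G hiding (V; order)

  Proper : ∀ {k} → (V G → Fin k) → Set
  Proper f = ∀ x y → x ~ y → f x ≢ f y

  Colourable : ℕ → Set
  Colourable k = ∃[ f ] Proper {k} f

  colourable? : U.Decidable Colourable
  colourable? k = map′ to from (any? (λ c → properᶠ? (finToFun c)))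
    where
    Properᶠ : (Fin (order G) → Fin k) → Set
    Properᶠ f = ∀ i j → vertex i ~ vertex j → f i ≢ f j

    properᶠ? : U.Decidable Properᶠ
    properᶠ? f = all? λ i → all? λ j →
      (vertex i ~? vertex j) →-dec ¬? (f i ≟ᶠ f j)

    to : ∃ (λ c → Properᶠ (finToFun c)) → Colourable k
    to (c , pr) = finToFun c ∘ index , λ x y x~y →
      pr (index x) (index y)
         (subst₂ _~_ (sym (vertex-index x)) (sym (vertex-index y)) x~y)

    from : Colourable k → ∃ (λ c → Properᶠ (finToFun c))
    from (f , pr) = funToFin (f ∘ vertex) , λ i j i~j eq →
      pr (vertex i) (vertex j) i~j
         (trans (sym (finToFun-funToFin (f ∘ vertex) i))
                (trans eq (finToFun-funToFin (f ∘ vertex) j)))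

  order-colourable : Colourable (order G)
  order-colourable = index , λ x y x~y eq →
    ~-irr (trans (sym (vertex-index x)) (trans (cong vertex eq) (vertex-index y))) x~y

  chromatic : ∃ (IsLeast Colourable)
  chromatic = least colourable? (order G , order-colourable)

  χ : ℕ
  χ = proj₁ chromatic

  record Cycle (k : ℕ) : Set where
    field
      3≤k       : 3 ≤ k
      at        : Fin k → V G
      injective : Injective _≡_ _≡_ at
      step      : ∀ i j → toℕ j ≡ suc (toℕ i) → at i ~ at j
      close     : ∀ i j → suc (toℕ i) ≡ k → toℕ j ≡ 0 → at i ~ at j

  HasOddGirth : ℕ → Set
  HasOddGirth = IsLeast (λ k → k % 2 ≡ 1 × Cycle k)

infixl 7 _⊗_

_⊗_ : Graph → Graph → Graph
G ⊗ H = record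
  { V     = G.V × H.V
  ; order = G.order * H.order
  ; enum  = ↔-sym *↔× ↔-∘ (G.enum ×-↔ H.enum)
  ; _~_   = λ (x , y) (x′ , y′) → x G.~ x′ × y H.~ y′
  ; _~?_  = λ (x , y) (x′ , y′) → (x G.~? x′) ×-dec (y H.~? y′)
  ; ~-sym = λ (e , e′) → G.~-sym e , H.~-sym e′
  ; ~-irr = λ eq (e , _) → G.~-irr (cong proj₁ eq) e
  }
  where
  module G = Graph G
  module H = Graph H

infix 8 _[K_]

_[K_] : Graph → ℕ → Graph
G [K q ] = record
  { V     = G.V × Fin q
  ; order = G.order * q
  ; enum  = ↔-sym *↔× ↔-∘ (G.enum ×-↔ ↔-id (Fin q))
  ; _~_   = λ (x , i) (y , j) → x G.~ y ⊎ (x ≡ y × i ≢ j)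
  ; _~?_  = λ (x , i) (y , j) → (x G.~? y) ⊎-dec ((x G.≟ⱽ y) ×-dec ¬? (i ≟ᶠ j))
  ; ~-sym = λ where
      (inj₁ e)           → inj₁ (G.~-sym e)
      (inj₂ (x≡y , i≢j)) → inj₂ (sym x≡y , i≢j ∘ sym)
  ; ~-irr = λ where
      eq (inj₁ e)         → G.~-irr (cong proj₁ eq) e
      eq (inj₂ (_ , i≢j)) → i≢j (cong proj₂ eq)
  }
  where module G = Graph G

-- The infimum of χ(G[K_q])/q over q ≥ 1 is represented by its (strict)
-- lower cut: r lies strictly below an infimum exactly when some s > r is
-- a lower bound.

infix 4 _<χf_

_<χf_ : ℚᵘ → Graph → Set
r <χf G = ∃[ s ] r ℚᵘ.< s × (∀ q .{{_ : NonZero q}} → s ℚᵘ.≤ (ℤ.+ χ (G [K q ])) ℚᵘ./ q)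

threshold : ∀ n → .{{NonZero (n ∸ 1)}} → ℚᵘ
threshold n = (ℤ.+ 3) ℚᵘ./ 1 ℚᵘ.+ (ℤ.+ 4) ℚᵘ./ (n ∸ 1)

-- The component NonZero (order G ∸ 1) only makes the fraction 4/(n − 1)
-- meaningful; it holds for every graph containing a 7-cycle.
Admissible : Graph → Set
Admissible G =
  HasOddGirth G 7 × Σ[ nz ∈ NonZero (order G ∸ 1) ] threshold (order G) {{nz}} <χf G

record [_⋯_] (a b : ℕ) : Set where
  constructor mk
  field
    val : ℕ
    .lo : a ≤ val
    .hi : val ≤ b

open [_⋯_] public using (val)

val-injective : ∀ {a b} {i j : [ a ⋯ b ]} → val i ≡ val j → i ≡ j
val-injective {i = mk _ _ _} {j = mk _ _ _} refl = refl

interval↔Fin : ∀ {a b} → [ a ⋯ b ] ↔ Fin (suc b ∸ a)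
interval↔Fin {a} {b} = mk↔ₛ′ to from to∘from from∘to
  where
  to : [ a ⋯ b ] → Fin (suc b ∸ a)
  to (mk v lo hi) = fromℕ< (∸-monoˡ-< (s≤s hi) lo)

  from : Fin (suc b ∸ a) → [ a ⋯ b ]
  from i = mk (a + toℕ i) (m≤m+n a (toℕ i))
    (s≤s⁻¹ (subst (_≤ suc b) (+-suc a (toℕ i)) (bound (toℕ<n i))))
    where
    bound : ∀ {k} → suc k ≤ suc b ∸ a → a + suc k ≤ suc b
    bound {k} lt = subst (a + suc k ≤_) (m+[n∸m]≡n a≤) (+-monoʳ-≤ a lt)
      where
      a≤ : a ≤ suc b
      a≤ = <⇒≤ (m∸n≢0⇒n<m λ eq → n≮0 (subst (suc k ≤_) eq lt))

  to∘from : ∀ i → to (from i) ≡ i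
  to∘from i = toℕ-injective (trans (toℕ-fromℕ< _) (m+n∸m≡n a (toℕ i)))

  from∘to : ∀ i → from (to i) ≡ i
  from∘to (mk v lo hi) = val-injective
    (trans (cong (a +_) (toℕ-fromℕ< (∸-monoˡ-< (s≤s hi) lo)))
           (m+[n∸m]≡n (recompute (a ≤? v) lo)))

module _ (p q : ℕ) where

  data HVertex : Set where
    g : [ 1 ⋯ 3 * q + 2 ] → HVertex
    φ : HVertex
    μ : [ 1 ⋯ p ] → [ q + 2 ⋯ 3 * q + 2 ] → HVertex
    θ : [ 1 ⋯ p ] → [ 2 * q + 2 ⋯ 3 * q + 2 ] → HVertex

  infix 4 _⟶_ _⟶?_

  -- Each edge is listed in one direction; adjacency is the symmetric closure.
  _⟶_ : Rel HVertex 0ℓ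
  g i   ⟶ g j     = val i ≢ val j
  φ     ⟶ g i     = p < val i
  μ i t ⟶ μ i′ t′ = val i ≡ val i′ × val t ≢ val t′
  μ i t ⟶ g j     = val j ≡ val i ⊎ (2 * q + 1 < val j × val j ≢ val t)
  θ i t ⟶ φ       = ⊤
  θ i t ⟶ μ i′ t′ = val i ≡ val i′ × val t ≡ val t′
  θ i t ⟶ g j     = val j ≢ val i × val j ≢ val t
  _     ⟶ _       = ⊥

  _⟶?_ : Decidable _⟶_
  g i   ⟶? g j     = ¬? (val i ≟ val j)
  g _   ⟶? φ       = no λ ()
  g _   ⟶? μ _ _   = no λ ()
  g _   ⟶? θ _ _   = no λ ()
  φ     ⟶? g i     = p <? val i
  φ     ⟶? φ       = no λ ()
  φ     ⟶? μ _ _   = no λ ()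
  φ     ⟶? θ _ _   = no λ ()
  μ i t ⟶? g j     = (val j ≟ val i) ⊎-dec ((2 * q + 1 <? val j) ×-dec ¬? (val j ≟ val t))
  μ _ _ ⟶? φ       = no λ ()
  μ i t ⟶? μ i′ t′ = (val i ≟ val i′) ×-dec ¬? (val t ≟ val t′)
  μ _ _ ⟶? θ _ _   = no λ ()
  θ i t ⟶? g j     = ¬? (val j ≟ val i) ×-dec ¬? (val j ≟ val t)
  θ _ _ ⟶? φ       = yes tt
  θ i t ⟶? μ i′ t′ = (val i ≟ val i′) ×-dec (val t ≟ val t′)
  θ _ _ ⟶? θ _ _   = no λ ()

  ⟶-irr : ∀ x → ¬ (x ⟶ x)
  ⟶-irr (g _)   i≢i       = i≢i refl
  ⟶-irr (μ _ _) (_ , t≢t) = t≢t refl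

  HVertex↔⊎ : HVertex ↔ ([ 1 ⋯ 3 * q + 2 ] ⊎ ⊤ ⊎
                         ([ 1 ⋯ p ] × [ q + 2 ⋯ 3 * q + 2 ]) ⊎
                         ([ 1 ⋯ p ] × [ 2 * q + 2 ⋯ 3 * q + 2 ]))
  HVertex↔⊎ = mk↔ₛ′
    (λ { (g i)   → inj₁ i
       ; φ       → inj₂ (inj₁ tt)
       ; (μ i t) → inj₂ (inj₂ (inj₁ (i , t)))
       ; (θ i t) → inj₂ (inj₂ (inj₂ (i , t))) })
    (λ { (inj₁ i)                      → g i
       ; (inj₂ (inj₁ tt))              → φ
       ; (inj₂ (inj₂ (inj₁ (i , t)))) → μ i t
       ; (inj₂ (inj₂ (inj₂ (i , t)))) → θ i t })
    (λ { (inj₁ _)               → refl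
       ; (inj₂ (inj₁ _))        → refl
       ; (inj₂ (inj₂ (inj₁ _))) → refl
       ; (inj₂ (inj₂ (inj₂ _))) → refl })
    (λ { (g _) → refl ; φ → refl ; (μ _ _) → refl ; (θ _ _) → refl })

  private
    ⊎↔Fin : ∀ {A B : Set} {m n} → A ↔ Fin m → B ↔ Fin n → (A ⊎ B) ↔ Fin (m + n)
    ⊎↔Fin e f = ↔-sym +↔⊎ ↔-∘ (e ⊎-↔ f)

    ×↔Fin : ∀ {A B : Set} {m n} → A ↔ Fin m → B ↔ Fin n → (A × B) ↔ Fin (m * n)
    ×↔Fin e f = ↔-sym *↔× ↔-∘ (e ×-↔ f)

  H : Graph
  H = record
    { V     = HVertex
    ; order = _
    ; enum  = ⊎↔Fin interval↔Fin (⊎↔Fin (↔-sym 1↔⊤)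
                (⊎↔Fin (×↔Fin interval↔Fin interval↔Fin) (×↔Fin interval↔Fin interval↔Fin)))
              ↔-∘ HVertex↔⊎
    ; _~_   = SymClosure _⟶_
    ; _~?_  = λ x y → map′ (λ { (inj₁ e) → fwd e ; (inj₂ e) → bwd e })
                           (λ { (fwd e) → inj₁ e ; (bwd e) → inj₂ e })
                           ((x ⟶? y) ⊎-dec (y ⟶? x))
    ; ~-sym = symmetric _⟶_
    ; ~-irr = λ { refl (fwd e) → ⟶-irr _ e ; refl (bwd e) → ⟶-irr _ e }
    }

{-# OPTIONS --safe #-}
module Submission where

-- G: a colouring of F[K_q] with 3q + 2 colours would give χ_f(F) ≤ 3 + 2/q ≤ 3 + 4/(p − 1).
--
-- H: in a c-colouring with g_i coloured i, φ receives some i ≤ p. Each θ_{i,t} is then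
-- forced to t, so no μ_{i,t} has colour t, and all 2q + 1 of them together with g_i
-- form a clique coloured from [2q + 1].
--
-- G × H: map H to functions V(G) → [c] so that adjacent vertices of H get functions differing
-- along every edge of G. Send g_i to
-- the constant i, φ to v_i ↦ i, and θ_{i,t} to t on the closed neighbourhood of v_i and i
-- elsewhere. As F has odd girth 7, the ball of radius 2 around v_i is bipartite, so its
-- blow-up has a colouring by the 2q colours of [2q + 1] ∖ {i}, shared by all μ_{i,t};
-- outside the ball μ_{i,t} is constant, equal to t up to a recolouring that avoids i.

open import Data.Empty using (⊥)
open import Data.Fin using (Fin; zero; suc; toℕ; inject₁; inject≤; fromℕ; punchOut)
open import Data.Fin.Patterns
open import Data.Fin.Properties
  using (any?; injective⇒≤; punchOut-injective; inject≤-injective; toℕ-injective; toℕ-inject₁; toℕ-fromℕ; toℕ<n)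
  renaming (_≟_ to _≟ᶠ_)
open import Data.Integer as ℤ using ()
import Data.Integer.Properties as ℤ
open import Data.Nat using (ℕ; zero; suc; _+_; _*_; _∸_; _≤_; _<_; NonZero; s≤s; z≤n; _≟_; _≤?_)
open import Data.Nat.Properties
open import Data.Nat.Solver using (module +-*-Solver)
open import Data.Product using (_×_; Σ-syntax; ∃-syntax; _,_; proj₁; proj₂)
import Data.Rational.Unnormalised.Properties as ℚᵘ
open import Data.Sum using (_⊎_; inj₁; inj₂; [_,_])
open import Data.Unit using (tt)
open import Data.Vec using (Vec; []; _∷_; lookup)
open import Data.Vec.Relation.Unary.All using ([]; _∷_)
open import Data.Vec.Relation.Unary.AllPairs using ([]; _∷_)
open import Data.Vec.Relation.Unary.Unique.Propositional using (Unique)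
open import Data.Vec.Relation.Unary.Unique.Propositional.Properties using (lookup-injective)
open import Function using (_∘_; _↔_; Injection; Inverse)
open import Function.Construct.Symmetry using (↔-sym)
open import Function.Definitions using (Injective)
open import Function.Properties.Inverse using (↔⇒↣)
open import Relation.Binary.Construct.Closure.Symmetric using (fwd; bwd)
open import Relation.Binary.Definitions using (Decidable)
open import Relation.Binary.PropositionalEquality hiding ([_])
open import Relation.Nullary using (¬_; yes; no; contradiction)
open import Relation.Nullary.Decidable using (decidable-stable; map′; _×-dec_; _⊎-dec_; recompute)
open import Defs

-- Finite counting and integer intervals.

-- Pigeonhole: punching out a missed value would leave an injection into a smaller `Fin`.
injective⇒surjective : ∀ {n} {f : Fin n → Fin n} → Injective _≡_ _≡_ f → ∀ k → ∃[ i ] f i ≡ k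
injective⇒surjective {suc n} {f} inj k with any? (λ i → f i ≟ᶠ k)
... | yes hit = hit
... | no ¬hit = contradiction (injective⇒≤ {f = λ i → punchOut (miss i)} λ {i} {j} →
                  inj ∘ punchOut-injective (miss i) (miss j)) 1+n≰n
  where
  miss : ∀ i → k ≢ f i
  miss i eq = ¬hit (i , sym eq)

↔-injective : ∀ {A B : Set} (e : A ↔ B) → Injective _≡_ _≡_ (Inverse.to e)
↔-injective e = Injection.injective (↔⇒↣ e)

lower : ∀ {a b} (i : [ a ⋯ b ]) → a ≤ val i
lower {a} (mk v lo _) = recompute (a ≤? v) lo

upper : ∀ {a b} (i : [ a ⋯ b ]) → val i ≤ b
upper {b = b} (mk v _ hi) = recompute (v ≤? b) hi

module _ {a b : ℕ} where

  open Inverse (interval↔Fin {a} {b}) public using () renaming (to to rank; from to unrank)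

  rank-injective : ∀ i j → rank i ≡ rank j → val i ≡ val j
  rank-injective i j eq = cong val (↔-injective (interval↔Fin {a} {b}) {i} {j} eq)

  unrank-injective : ∀ {j k} → val (unrank j) ≡ val (unrank k) → j ≡ k
  unrank-injective = ↔-injective (↔-sym (interval↔Fin {a} {b})) ∘ val-injective

-- Chromatic number and cycles from vertex lists.

module _ (G : Graph) where

  open Graph G using (V; _~_; ~-irr)

  colourable-mono : ∀ {m n} → m ≤ n → Colourable G m → Colourable G n
  colourable-mono m≤n (f , proper) =
    (λ x → inject≤ (f x) m≤n) , λ x y x~y → proper x y x~y ∘ inject≤-injective m≤n m≤n _ _

  colourable⇒χ≤ : ∀ {n} → Colourable G n → χ G ≤ n
  colourable⇒χ≤ = proj₂ (proj₂ (chromatic G)) _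

  ¬colourable⇒<χ : ∀ {n} → ¬ Colourable G n → n < χ G
  ¬colourable⇒<χ ¬col = ≰⇒> λ χ≤n → ¬col (colourable-mono χ≤n (proj₁ (proj₂ (chromatic G))))

  path⇒cycle : ∀ {k} (xs : Vec V (3 + k)) → Unique xs →
    (∀ i → lookup xs (inject₁ i) ~ lookup xs (suc i)) →
    lookup xs (fromℕ (2 + k)) ~ lookup xs zero → Cycle G (3 + k)
  path⇒cycle {k} xs unique path closing = record
    { 3≤k       = m≤m+n 3 k
    ; at        = lookup xs
    ; injective = lookup-injective unique _ _
    ; step      = step
    ; close     = close
    }
    where
    step : ∀ i j → toℕ j ≡ suc (toℕ i) → lookup xs i ~ lookup xs j
    step i (suc j) eq = subst (λ i → lookup xs i ~ lookup xs (suc j))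
      (toℕ-injective (trans (toℕ-inject₁ j) (suc-injective eq))) (path j)

    close : ∀ i j → suc (toℕ i) ≡ 3 + k → toℕ j ≡ 0 → lookup xs i ~ lookup xs j
    close i zero eq _ = subst (λ i → lookup xs i ~ lookup xs zero)
      (toℕ-injective (trans (toℕ-fromℕ (2 + k)) (sym (suc-injective eq)))) closing

  ~⇒≢ : ∀ {x y} → x ~ y → x ≢ y
  ~⇒≢ x~y x≡y = ~-irr x≡y x~y

-- Odd girth 7: balls of radius 2 are bipartite.

module OddGirth7 (F : Graph) (girth : HasOddGirth F 7) where

  open Graph F using (V; _~_; ~-sym)

  no-triangle : ∀ {a b c} → a ~ b → b ~ c → ¬ c ~ a
  no-triangle {a} {b} {c} a~b b~c c~a = contradiction (proj₂ girth 3 (refl , cycle)) (<⇒≱ (m≤m+n 4 3))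
    where
    cycle : Cycle F 3
    cycle = path⇒cycle F (a ∷ b ∷ c ∷ [])
      ((~⇒≢ F a~b ∷ ≢-sym (~⇒≢ F c~a) ∷ []) ∷ (~⇒≢ F b~c ∷ []) ∷ [] ∷ [])
      (λ { 0F → a~b ; 1F → b~c }) c~a

  -- Two vertices at distance two along a closed 5-walk are also joined by the other three edges.
  -- This lemma therefore separates them, and `no-pentagon` gets a genuine cycle.
  walk₃-open : ∀ {a b c d} → a ~ b → b ~ c → c ~ d → d ≢ a
  walk₃-open a~b b~c c~a refl = no-triangle a~b b~c c~a

  no-pentagon : ∀ {a b c d e} → a ~ b → b ~ c → c ~ d → d ~ e → ¬ e ~ a
  no-pentagon {a} {b} {c} {d} {e} a~b b~c c~d d~e e~a =
    contradiction (proj₂ girth 5 (refl , cycle)) (<⇒≱ (m≤m+n 6 1))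
    where
    cycle : Cycle F 5
    cycle = path⇒cycle F (a ∷ b ∷ c ∷ d ∷ e ∷ [])
      ( (~⇒≢ F a~b ∷ walk₃-open c~d d~e e~a ∷ ≢-sym (walk₃-open a~b b~c c~d) ∷ ≢-sym (~⇒≢ F e~a) ∷ [])
      ∷ (~⇒≢ F b~c ∷ walk₃-open d~e e~a a~b ∷ ≢-sym (walk₃-open b~c c~d d~e) ∷ [])
      ∷ (~⇒≢ F c~d ∷ walk₃-open e~a a~b b~c ∷ [])
      ∷ (~⇒≢ F d~e ∷ []) ∷ [] ∷ [])
      (λ { 0F → a~b ; 1F → b~c ; 2F → c~d ; 3F → d~e }) e~a

  -- Walks of length 0 or 2 from `v`: the even side of the ball of radius 2, the odd side being the
  -- neighbourhood of `v`.
  Even : V → V → Set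
  Even v x = v ≡ x ⊎ ∃[ w ] v ~ w × w ~ x

  odd-independent : ∀ {v x y} → v ~ x → v ~ y → ¬ x ~ y
  odd-independent v~x v~y x~y = no-triangle v~x x~y (~-sym v~y)

  -- Such an edge would close an odd walk of length 1, 3 or 5.
  even-independent : ∀ {v x y} → Even v x → Even v y → ¬ x ~ y
  even-independent (inj₁ refl) (inj₁ refl) x~y = ~⇒≢ F x~y refl
  even-independent (inj₁ refl) (inj₂ (w , v~w , w~y)) v~y = no-triangle v~w w~y (~-sym v~y)
  even-independent (inj₂ (w , v~w , w~x)) (inj₁ refl) x~v = no-triangle v~w w~x x~v
  even-independent (inj₂ (w , v~w , w~x)) (inj₂ (w′ , v~w′ , w′~y)) x~y =
    no-pentagon v~w w~x x~y (~-sym w′~y) (~-sym v~w′)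

  data Layer (v x : V) : Set where
    odd  : v ~ x → Layer v x
    even : Even v x → Layer v x
    far  : ¬ v ~ x → ¬ Even v x → Layer v x

  open Graph F using (_~?_; _≟ⱽ_; index; vertex; vertex-index)

  even? : Decidable Even
  even? v x = v ≟ⱽ x ⊎-dec map′
    (λ (i , p) → vertex i , p)
    (λ (w , v~w , w~x) → index w , subst (v ~_) (sym (vertex-index w)) v~w
                                 , subst (_~ x) (sym (vertex-index w)) w~x)
    (any? λ i → (v ~? vertex i) ×-dec (vertex i ~? x))

  layer : ∀ v x → Layer v x
  layer v x with v ~? x | even? v x
  ... | yes v~x | _       = odd v~x
  ... | no _    | yes e   = even e
  ... | no ¬v~x | no ¬e   = far ¬v~x ¬e

-- The lower bound on the chromatic number of G.

-- The hypothesis `gap` is 3 + 4/m < x/q with denominators cleared, in the shape that unnormalised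
-- rationals produce. Since m ≤ 2q, 4/m is at least 2/q.
threshold-numerator : ∀ {m} q {x} → m ≤ 2 * q → (3 * m + 4 * 1) * q < x * (1 * m) → 3 * q + 2 < x
threshold-numerator {m} q {x} m≤2q gap = *-cancelʳ-< m (3 * q + 2) x (begin-strict
  (3 * q + 2) * m           ≡⟨ solve 2 (λ q m → (con 3 :* q :+ con 2) :* m := con 3 :* m :* q :+ con 2 :* m) refl q m ⟩
  3 * m * q + 2 * m         ≤⟨ +-monoʳ-≤ (3 * m * q) (*-monoʳ-≤ 2 m≤2q) ⟩
  3 * m * q + 2 * (2 * q)   ≡⟨ solve 2 (λ q m → con 3 :* m :* q :+ con 2 :* (con 2 :* q)
                                 := (con 3 :* m :+ con 4 :* con 1) :* q) refl q m ⟩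
  (3 * m + 4 * 1) * q       <⟨ gap ⟩
  x * (1 * m)               ≡⟨ cong (x *_) (*-identityˡ m) ⟩
  x * m                     ∎)
  where
  open ≤-Reasoning
  open +-*-Solver

large-χ : ∀ (F : Graph) q {n} .{{nz : NonZero (n ∸ 1)}} → n ∸ 1 ≤ 2 * q → threshold n <χf F → 3 * q + 2 < χ (F [K q ])
-- The lower bound `s` is applied at this very `q`. The cases q = 0 and n ≤ 1 are empty, because
-- `n ∸ 1` is nonzero and at most `2 * q`.
large-χ F (suc q) {suc (suc m)} m≤2q (s , r<s , s≤) = threshold-numerator (suc q) m≤2q
  (ℤ.drop‿+<+ (subst (λ z → ℤ.+ ((3 * suc m + 4 * 1) * suc q) ℤ.< z)
    (sym (ℤ.pos-* (χ (F [K suc q ])) (1 * suc m)))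
    (ℚᵘ.drop-*<* (ℚᵘ.<-≤-trans r<s (s≤ (suc q))))))

-- H has no colouring with c colours.

module _ {p q : ℕ} where

  open Graph (H p q) using (_~_)

  Normal : Set
  Normal = Σ[ name ∈ (HVertex p q → [ 1 ⋯ 3 * q + 2 ]) ]
    (∀ {x y} → x ~ y → val (name x) ≢ val (name y)) × (∀ j → name (g j) ≡ j)

  -- The clique of the g_i uses every colour, so renaming colours makes g_i coloured i.
  normalise : Colourable (H p q) (3 * q + 2) → Normal
  normalise (f , proper) = name , name-proper , λ j → g-injective (f-name (f (g j)))
    where
    g-injective : ∀ {i j} → f (g i) ≡ f (g j) → i ≡ j
    g-injective {i} {j} eq with val i ≟ val j
    ... | yes i≡j = val-injective i≡j
    ... | no i≢j  = contradiction eq (proper _ _ (fwd i≢j))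

    surjective : ∀ k → ∃[ i ] f (g (unrank i)) ≡ k
    surjective = injective⇒surjective (unrank-injective ∘ cong val ∘ g-injective)

    hit : Fin (3 * q + 2) → Fin (3 * q + 2)
    hit k = proj₁ (surjective k)

    f-name : ∀ k → f (g (unrank (hit k))) ≡ k
    f-name k = proj₂ (surjective k)

    name : HVertex p q → [ 1 ⋯ 3 * q + 2 ]
    name x = unrank (hit (f x))

    name-proper : ∀ {x y} → x ~ y → val (name x) ≢ val (name y)
    name-proper {x} {y} x~y eq = proper x y x~y
      (trans (sym (f-name (f x))) (trans (cong (f ∘ g) (val-injective eq)) (f-name (f y))))

  module Normalised (p≤ : p ≤ 2 * q + 1) (name : HVertex p q → [ 1 ⋯ 3 * q + 2 ])
    (name-proper : ∀ {x y} → x ~ y → val (name x) ≢ val (name y)) (name-g : ∀ j → name (g j) ≡ j) where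

    name-avoids : ∀ {x j} → x ~ g j → val (name x) ≢ val j
    name-avoids {j = j} x~j eq = name-proper x~j (trans eq (cong val (sym (name-g j))))

    -- The vertex `g (name x)` already has the colour of `x`. Every adjacency to the `g j` thus
    -- becomes a restriction on colours.
    name-self : ∀ x → ¬ x ~ g (name x)
    name-self x x~x = name-avoids x~x refl

    name-φ≤p : val (name φ) ≤ p
    name-φ≤p = ≮⇒≥ (name-self φ ∘ fwd)

    i : [ 1 ⋯ p ]
    i = mk (val (name φ)) (lower (name φ)) name-φ≤p

    -- Adjacency to the `g j` leaves only the colours i and t, and i is taken by the neighbour `φ`.
    name-θ : ∀ t → val (name (θ i t)) ≡ val t
    name-θ t = decidable-stable (val (name (θ i t)) ≟ val t) λ ≢t →
      name-self (θ i t) (fwd (name-proper {θ i t} {φ} (fwd tt) , ≢t))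

    name-μ≢i : ∀ t → val (name (μ i t)) ≢ val i
    name-μ≢i t = name-avoids {μ i t} {name φ} (fwd (inj₁ refl))

    name-μ≤ : ∀ t → val (name (μ i t)) ≤ 2 * q + 1
    name-μ≤ t = ≮⇒≥ λ large → name-self (μ i t) (fwd (inj₂ (large , ≢t large)))
      where
      ≢t : 2 * q + 1 < val (name (μ i t)) → val (name (μ i t)) ≢ val t
      ≢t large eq = name-proper {θ i t′} {μ i t} (fwd (refl , refl)) (trans (name-θ t′) (sym eq))
        where
        t′ : [ 2 * q + 2 ⋯ 3 * q + 2 ]
        t′ = mk (val t) (subst₂ _≤_ (sym (+-suc (2 * q) 1)) eq large) (upper t)

    palette : Fin (suc (3 * q + 2) ∸ (q + 2)) → [ q + 2 ⋯ 3 * q + 2 ]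
    palette = unrank

    -- Index `zero` stands for `g i`, the others for the `μ i t`: 2q + 2 distinct colours in an
    -- interval of length 2q + 1.
    clique : Fin (suc (suc (3 * q + 2) ∸ (q + 2))) → [ 1 ⋯ 2 * q + 1 ]
    clique zero    = mk (val i) (lower i) (≤-trans name-φ≤p p≤)
    clique (suc k) = mk (val (name (μ i t))) (lower (name (μ i t))) (name-μ≤ t)
      where t = palette k

    clique-val-injective : ∀ j k → val (clique j) ≡ val (clique k) → j ≡ k
    clique-val-injective zero    zero    _  = refl
    clique-val-injective zero    (suc k) eq = contradiction (sym eq) (name-μ≢i _)
    clique-val-injective (suc j) zero    eq = contradiction eq (name-μ≢i _)
    clique-val-injective (suc j) (suc k) eq = cong suc (unrank-injective {q + 2}
      (decidable-stable (val (palette j) ≟ val (palette k)) λ j≢k →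
        name-proper {μ i (palette j)} {μ i (palette k)} (fwd (refl , j≢k)) eq))

    clique-injective : Injective _≡_ _≡_ (rank ∘ clique)
    clique-injective {j} {k} = clique-val-injective j k ∘ rank-injective (clique j) (clique k)

    size : 1 + (suc (3 * q + 2) ∸ (q + 2)) ≡ 1 + (2 * q + 1)
    size = cong (1 +_) (trans (cong (_∸ (q + 2)) (solve 1 (λ q → con 1 :+ (con 3 :* q :+ con 2)
             := (con 2 :* q :+ con 1) :+ (q :+ con 2)) refl q)) (m+n∸n≡m (2 * q + 1) (q + 2)))
      where open +-*-Solver

    absurd : ⊥
    absurd = 1+n≰n (subst (_≤ 2 * q + 1) size (injective⇒≤ clique-injective))

  ¬normal : p ≤ 2 * q + 1 → ¬ Normal
  ¬normal p≤ (name , name-proper , name-g) = Normalised.absurd p≤ name name-proper name-g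

  H-uncolourable : p ≤ 2 * q + 1 → ¬ Colourable (H p q) (3 * q + 2)
  H-uncolourable p≤ col = ¬normal p≤ (normalise col)

-- A colouring of G × H with c colours.

module ProductColouring (F : Graph) (girth : HasOddGirth F 7) (q : ℕ) (p≤ : Graph.order F ≤ 2 * q + 1) where

  open Graph F using (V; _~_; ~-sym; _~?_; _≟ⱽ_; index; vertex; vertex-index) renaming (order to p)
  open OddGirth7 F girth
  open Graph (F [K q ]) using () renaming (_~_ to _~ᴳ_)

  c : ℕ
  c = 3 * q + 2

  small⇒≤c : ∀ {n} → n ≤ 2 * q + 1 → n ≤ c
  small⇒≤c n≤ = ≤-trans n≤ (+-mono-≤ (*-monoˡ-≤ q (m≤m+n 2 1)) (m≤m+n 1 1))

  v : [ 1 ⋯ p ] → V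
  v i = vertex (rank i)

  φ-colour : V → [ 1 ⋯ p ]
  φ-colour x = unrank (index x)

  v-φ-colour : ∀ x → v (φ-colour x) ≡ x
  v-φ-colour x = trans (cong vertex (Inverse.strictlyInverseˡ (interval↔Fin {1} {p}) (index x))) (vertex-index x)

  Near : V → V → Set
  Near u x = u ≡ x ⊎ u ~ x

  near? : Decidable Near
  near? u x = (u ≟ⱽ x) ⊎-dec (u ~? x)

  widen : ∀ {b} (i : [ 1 ⋯ b ]) → .(b ≤ c) → [ 1 ⋯ c ]
  widen i b≤c = mk (val i) (lower i) (≤-trans (upper i) b≤c)

  p≤c : p ≤ c
  p≤c = small⇒≤c p≤

  -- With q + 1 left out of the palette, [1, q] and [q + 2, 2q + 1] properly
  -- colour the bipartite ball of radius 2, and t ≥ q + 2 is free at distance ≥ 3.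
  shade : ∀ {u x} → Layer u x → Fin q → ℕ → ℕ
  shade (odd _)   k t = suc (suc (q + toℕ k))
  shade (even _)  k t = suc (toℕ k)
  shade (far _ _) k t = t

  low< : ∀ (k : Fin q) {t} → q + 2 ≤ t → suc (toℕ k) < t
  low< k q+2≤t = ≤-trans (s≤s (toℕ<n k)) (≤-trans (subst (suc q ≤_) (+-comm 2 q) (n≤1+n (suc q))) q+2≤t)

  low≢high : ∀ (k l : Fin q) → suc (toℕ k) ≢ suc (suc (q + toℕ l))
  low≢high k l = <⇒≢ (low< k (subst (_≤ suc (suc (q + toℕ l))) (+-comm 2 q) (s≤s (s≤s (m≤m+n q _)))))

  -- The odd and even palettes are disjoint. Inside either layer adjacent vertices share their base
  -- vertex, so their copies `k` and `l` differ. No far vertex is adjacent to an odd one, and even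
  -- colours lie below `s` and `t`.
  shade-proper : ∀ {u x y k l s t} (lx : Layer u x) (ly : Layer u y) → (x , k) ~ᴳ (y , l) →
    q + 2 ≤ s → q + 2 ≤ t → s ≢ t → shade lx k s ≢ shade ly l t
  shade-proper (odd u~x)  (odd u~y)  (inj₁ x~y) _ _ _ = contradiction x~y (odd-independent u~x u~y)
  shade-proper (odd _)    (odd _)    (inj₂ (_ , k≢l)) _ _ _ =
    k≢l ∘ toℕ-injective ∘ +-cancelˡ-≡ (suc (suc q)) _ _
  shade-proper {k = k} {l} (odd _)  (even _) _ _ _ _ = ≢-sym (low≢high l k)
  shade-proper {k = k} {l} (even _) (odd _)  _ _ _ _ = low≢high k l
  shade-proper (even ex)  (even ey)  (inj₁ x~y) _ _ _ = contradiction x~y (even-independent ex ey)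
  shade-proper (even _)   (even _)   (inj₂ (_ , k≢l)) _ _ _ = k≢l ∘ toℕ-injective ∘ suc-injective
  shade-proper (odd u~x)  (far _ ¬e) (inj₁ x~y) _ _ _ = contradiction (inj₂ (_ , u~x , x~y)) ¬e
  shade-proper (odd u~x)  (far ¬u~x _) (inj₂ (refl , _)) _ _ _ = contradiction u~x ¬u~x
  shade-proper (far _ ¬e) (odd u~y)  (inj₁ x~y) _ _ _ = contradiction (inj₂ (_ , u~y , ~-sym x~y)) ¬e
  shade-proper (far ¬u~x _) (odd u~x) (inj₂ (refl , _)) _ _ _ = contradiction u~x ¬u~x
  shade-proper {k = k} (even _)  (far _ _) _ _ t≥ _ = <⇒≢ (low< k t≥)
  shade-proper {l = l} (far _ _) (even _)  _ s≥ _ _ = ≢-sym (<⇒≢ (low< l s≥))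
  shade-proper (far _ _)  (far _ _)  _ _ _ s≢t = s≢t

  shade≢mid : ∀ {u x t} (lx : Layer u x) k → q + 2 ≤ t → shade lx k t ≢ q + 1
  shade≢mid (odd _)   k _  eq = <⇒≢ (subst (_< suc (suc (q + toℕ k))) (+-comm 1 q) (s≤s (s≤s (m≤m+n q _)))) (sym eq)
  shade≢mid (even _)  k _  eq = <⇒≢ (subst (suc (toℕ k) <_) (+-comm 1 q) (s≤s (toℕ<n k))) eq
  shade≢mid {t = t} (far _ _) k t≥ eq = <⇒≢ (subst (_≤ t) (+-suc q 1) t≥) (sym eq)

  high-small : ∀ (k : Fin q) → suc (suc (q + toℕ k)) ≤ 2 * q + 1
  high-small k = begin
    suc (suc (q + toℕ k)) ≡⟨ +-comm 1 (suc (q + toℕ k)) ⟩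
    suc (q + toℕ k) + 1   ≡⟨ cong (_+ 1) (sym (+-suc q (toℕ k))) ⟩
    q + suc (toℕ k) + 1   ≤⟨ +-monoˡ-≤ 1 (+-monoʳ-≤ q (≤-trans (toℕ<n k) (m≤m+n q 0))) ⟩
    2 * q + 1             ∎
    where open ≤-Reasoning

  low-small : ∀ (k : Fin q) → suc (toℕ k) ≤ 2 * q + 1
  low-small k = ≤-trans (toℕ<n k) (≤-trans (m≤m+n q (q + 0)) (m≤m+n (2 * q) 1))

  shade-inside : ∀ {u x t} (lx : Layer u x) k → Even u x ⊎ u ~ x → shade lx k t ≤ 2 * q + 1
  shade-inside (odd _)    k _      = high-small k
  shade-inside (even _)   k _      = low-small k
  shade-inside (far ¬o ¬e) k inside = contradiction inside [ ¬e , ¬o ]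

  shade-small : ∀ {u x t} (lx : Layer u x) k → shade lx k t ≤ 2 * q + 1 ⊎ shade lx k t ≡ t
  shade-small (odd _)   k = inj₁ (high-small k)
  shade-small (even _)  k = inj₁ (low-small k)
  shade-small (far _ _) k = inj₂ refl

  1≤shade : ∀ {u x t} (lx : Layer u x) k → q + 2 ≤ t → 1 ≤ shade lx k t
  1≤shade (odd _)   k _  = s≤s z≤n
  1≤shade (even _)  k _  = s≤s z≤n
  1≤shade (far _ _) k t≥ = ≤-trans (≤-trans (m≤n+m 1 (q + 1)) (≤-reflexive (+-assoc q 1 1))) t≥

  -- Trades the colour i, which μ_{i,t} must not use, for the unused q + 1.
  dodge : ℕ → ℕ → ℕ
  dodge i n with n ≟ i
  ... | yes _ = q + 1
  ... | no _  = n

  -- The hypothesis matters for i = q + 1: `dodge` then fixes i, and i is avoided only because it is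
  -- absent from the input.
  dodge≢ : ∀ i {n} → n ≢ q + 1 → dodge i n ≢ i
  dodge≢ i {n} n≢ eq with n ≟ i
  ... | yes n≡i = n≢ (trans n≡i (sym eq))
  ... | no n≢i  = n≢i eq

  dodge-injective : ∀ i {m n} → m ≢ q + 1 → n ≢ q + 1 → m ≢ n → dodge i m ≢ dodge i n
  dodge-injective i {m} {n} m≢ n≢ m≢n eq with m ≟ i | n ≟ i
  ... | yes m≡i | yes n≡i = m≢n (trans m≡i (sym n≡i))
  ... | yes _   | no _    = n≢ (sym eq)
  ... | no _    | yes _   = m≢ eq
  ... | no _    | no _    = m≢n eq

  dodge-cases : ∀ i n → dodge i n ≡ q + 1 ⊎ dodge i n ≡ n
  dodge-cases i n with n ≟ i
  ... | yes _ = inj₁ refl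
  ... | no _  = inj₂ refl

  mid≤ : q + 1 ≤ 2 * q + 1
  mid≤ = +-monoˡ-≤ 1 (m≤m+n q (q + 0))

  μ-colour : ∀ (i : [ 1 ⋯ p ]) → [ q + 2 ⋯ c ] → V → Fin q → ℕ
  μ-colour i t x k = dodge (val i) (shade (layer (v i) x) k (val t))

  -- This is what the edges from `μ i t` to `g j` need, where j > 2q + 1 and j ≠ t.
  μ-colour-small : ∀ i t x k → μ-colour i t x k ≤ 2 * q + 1 ⊎ μ-colour i t x k ≡ val t
  μ-colour-small i t x k with dodge-cases (val i) (shade (layer (v i) x) k (val t))
  ... | inj₁ eq = inj₁ (subst (_≤ 2 * q + 1) (sym eq) mid≤)
  ... | inj₂ eq = subst (λ n → n ≤ 2 * q + 1 ⊎ n ≡ val t) (sym eq) (shade-small (layer (v i) x) k)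

  μ-colour≤c : ∀ i t x k → μ-colour i t x k ≤ c
  μ-colour≤c i t x k with μ-colour-small i t x k
  ... | inj₁ small = small⇒≤c small
  ... | inj₂ eq    = subst (_≤ c) (sym eq) (upper t)

  1≤μ-colour : ∀ i t x k → 1 ≤ μ-colour i t x k
  1≤μ-colour i t x k with dodge-cases (val i) (shade (layer (v i) x) k (val t))
  ... | inj₁ eq = subst (1 ≤_) (sym eq) (m≤n+m 1 q)
  ... | inj₂ eq = subst (1 ≤_) (sym eq) (1≤shade (layer (v i) x) k (lower t))

  μ-colour≢i : ∀ i t x k → μ-colour i t x k ≢ val i
  μ-colour≢i i t x k = dodge≢ (val i) (shade≢mid (layer (v i) x) k (lower t))

  μ-colour-inside : ∀ i t x k → Even (v i) x ⊎ v i ~ x → μ-colour i t x k ≤ 2 * q + 1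
  μ-colour-inside i t x k inside with dodge-cases (val i) (shade (layer (v i) x) k (val t))
  ... | inj₁ eq = subst (_≤ 2 * q + 1) (sym eq) mid≤
  ... | inj₂ eq = subst (_≤ 2 * q + 1) (sym eq) (shade-inside (layer (v i) x) k inside)

  -- One step from the closed neighbourhood stays in the ball of radius 2. There `μ` uses colours up
  -- to 2q + 1, hence never the colour t that `θ i t` takes near `v i`.
  Near-step : ∀ {u x y k l} → Near u x → (x , k) ~ᴳ (y , l) → Even u y ⊎ u ~ y
  Near-step (inj₁ refl) (inj₁ u~y)        = inj₂ u~y
  Near-step (inj₁ refl) (inj₂ (refl , _)) = inj₁ (inj₁ refl)
  Near-step (inj₂ u~x)  (inj₁ x~y)        = inj₁ (inj₂ (_ , u~x , x~y))
  Near-step (inj₂ u~x)  (inj₂ (refl , _)) = inj₂ u~x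

  ~ᴳ⇒Near : ∀ {x y k l} → (x , k) ~ᴳ (y , l) → Near y x
  ~ᴳ⇒Near (inj₁ x~y)       = inj₂ (~-sym x~y)
  ~ᴳ⇒Near (inj₂ (x≡y , _)) = inj₁ (sym x≡y)

  large : (t : [ 2 * q + 2 ⋯ c ]) → 2 * q + 1 < val t
  large t = subst (_≤ val t) (+-suc (2 * q) 1) (lower t)

  colour : V × Fin q → HVertex p q → [ 1 ⋯ c ]
  colour (x , k) (g i)   = i
  colour (x , k) φ       = widen (φ-colour x) p≤c
  colour (x , k) (μ i t) = mk (μ-colour i t x k) (1≤μ-colour i t x k) (μ-colour≤c i t x k)
  colour (x , k) (θ i t) with near? (v i) x
  ... | yes _ = mk (val t) (≤-trans (s≤s z≤n) (large t)) (upper t)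
  ... | no _  = widen i p≤c

  colour-proper : ∀ {x y} a b → x ~ᴳ y → _⟶_ p q a b → val (colour x a) ≢ val (colour y b)
  colour-proper (g i) (g j) x~y i≢j = i≢j
  colour-proper {x , k} φ (g i) x~y p<i = <⇒≢ (≤-trans (s≤s (upper (φ-colour x))) p<i)
  colour-proper {x , k} {y , l} (μ i t) (μ i′ t′) x~y (i≡i′ , t≢t′) with refl ← val-injective {i = i} {i′} i≡i′ =
    dodge-injective (val i) (shade≢mid lx k (lower t)) (shade≢mid ly l (lower t′))
      (shade-proper lx ly x~y (lower t) (lower t′) t≢t′)
    where
    lx = layer (v i) x
    ly = layer (v i) y
  colour-proper {x , k} (μ i t) (g j) x~y (inj₁ j≡i) eq = μ-colour≢i i t x k (trans eq j≡i)
  colour-proper {x , k} (μ i t) (g j) x~y (inj₂ (j> , j≢t)) eq =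
    [ (λ small → <⇒≢ (≤-trans (s≤s small) j>) eq) , (λ eq′ → j≢t (trans (sym eq) eq′)) ] (μ-colour-small i t x k)
  colour-proper {x , k} {y , l} (θ i t) φ x~y tt with near? (v i) x
  ... | yes _    = ≢-sym (<⇒≢ (≤-trans (s≤s (≤-trans (upper (φ-colour y)) p≤)) (large t)))
  -- Here `θ` has colour i. If `φ` had it at `y`, then `y` would be `v i`, and its neighbour `x`
  -- would be near after all.
  ... | no ¬near = λ eq → ¬near (subst (λ u → Near u x)
                     (sym (trans (cong v (val-injective {1} {p} {i} {φ-colour y} eq)) (v-φ-colour y))) (~ᴳ⇒Near x~y))
  colour-proper {x , k} {y , l} (θ i t) (μ i′ t′) x~y (i≡i′ , t≡t′)
    with refl ← val-injective {i = i} {i′} i≡i′ | near? (v i) x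
  ... | yes near = ≢-sym (<⇒≢ (≤-trans (s≤s (μ-colour-inside i t′ y l (Near-step near x~y))) (large t)))
  -- Away from `v i` the colour of `θ` is i, which `dodge` keeps out of `μ`.
  ... | no _     = ≢-sym (μ-colour≢i i t′ y l)
  colour-proper {x , k} (θ i t) (g j) x~y (j≢i , j≢t) with near? (v i) x
  ... | yes _ = ≢-sym j≢t
  ... | no _  = ≢-sym j≢i

  colourable : Colourable (F [K q ] ⊗ H p q) c
  colourable = (λ (x , a) → rank (colour x a)) , λ where
    (x , a) (y , b) (x~y , fwd a→b) → colour-proper a b x~y a→b ∘ rank-injective (colour x a) (colour y b)
    -- An edge of H listed in reverse is handled by reversing the edge of G too.
    (x , a) (y , b) (x~y , bwd b→a) →
      ≢-sym (colour-proper b a (Graph.~-sym (F [K q ]) {x} {y} x~y) b→a) ∘ rank-injective (colour x a) (colour y b)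

theorem3 : ∀ (p : ℕ) →
    IsLeast (λ n → ∃[ F ] (Graph.order F ≡ n × Admissible F)) p →
    ∀ (F : Graph) → Graph.order F ≡ p → Admissible F →
    ∀ (q : ℕ) → p ∸ 1 ≤ 2 * q →
    let c = 3 * q + 2
        G = F [K q ]
    in c < χ G × c < χ (H p q) × χ (G ⊗ H p q) ≤ c
theorem3 p _ F refl (girth , nz , gap) q p∸1≤2q =
  large-χ F q {p} {{nz}} p∸1≤2q gap ,
  ¬colourable⇒<χ (H p q) (H-uncolourable p≤) ,
  colourable⇒χ≤ (F [K q ] ⊗ H p q) (ProductColouring.colourable F girth q p≤)
  where
  p≤ : p ≤ 2 * q + 1
  p≤ = ≤-trans (m≤n+m∸n p 1) (≤-trans (+-monoʳ-≤ 1 p∸1≤2q) (≤-reflexive (+-comm 1 (2 * q))))
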